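{- The worst-case performance ratio of the lower bound $\zeta(\mathrm{LP}_{\mathrm N})$ for the BPPS is zero: $$\varrho(\zeta(\mathrm{LP}_{\mathrm N}))=0.$$
   Context: Bin Packing Problem with Setups (BPPS). An instance consists of: a bin capacity $d\in\mathbb Z_{\ge1}$; items $\mathcal I=\{1,\dots,n\}$ with weights $w_i\in\mathbb Z_{\ge1}$; classes $\mathcal C=\{1,\dots,m\}$ and a partition $\{\mathcal I_1,\dots,\mathcal I_m\}$ of $\mathcal I$ into (nonempty) classes; for each class $c$ a setup weight $s_c\in\mathbb Z_{\ge0}$ and a setup cost $f_c\in\mathbb Z_{\ge0}$; a bin cost $r\in\mathbb Z_{\ge1}$. It is assumed that $w_i+s_c\le d$ for all $c\in\mathcal C$, $i\in\mathcal I_c$, and that the items cannot all be packed in a single bin, i.e. $\sum_{i\in\mathcal I}w_i+\sum_{c\in\mathcal C}s_c>d$. For $S\subseteq\mathcal I$ let $\mathcal C(S)=\{c\in\mathcal C: S\cap\mathcal I_c\neq\emptyset\}$. A packing pattern is a subset $S\subseteq\mathcal I$ with $\sum_{i\in S}w_i+\sum_{c\in\mathcal C(S)}s_c\le d$. A feasible solution is a partition $\mathcal S$ of $\mathcal I$ into (nonempty) packing patterns (used bins); its cost is $r|\mathcal S|+\sum_{S\in\mathcal S}\sum_{c\in\mathcal C(S)}f_c$. $OPT$ denotes the minimum cost of a feasible solution. For each instance let $k\in\mathbb Z_{\ge1}$ be an upper bound on the number of bins used in any optimal BPPS solution (for example $k=n$) and $\mathcal B=\{1,\dots,k\}$. The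 linear program $\mathrm{LP}_{\mathrm N}$ is: minimize $\sum_{b\in\mathcal B}\big(r z_b+\sum_{c\in\mathcal C}f_c y_{cb}\big)$ subject to - $\sum_{b\in\mathcal B}x_{ib}=1$ for all $i\in\mathcal I$; - $\sum_{i\in\mathcal I}w_ix_{ib}+\sum_{c\in\mathcal C}s_cy_{cb}\le d\,z_b$ for all $b\in\mathcal B$; - $x_{ib}\le y_{cb}$ for all $c\in\mathcal C$, $i\in\mathcal I_c$, $b\in\mathcal B$; - $0\le x_{ib}\le1$, $0\le y_{cb}\le1$, $0\le z_b\le1$ for all $i\in\mathcal I,c\in\mathcal C,b\in\mathcal B$. $\zeta(\mathrm{LP}_{\mathrm N})$ denotes its optimal objective function value; it is a lower bound on $OPT$. For a lower bound $LB$ on the optimum of a minimization problem, with $LB(I)$ its value and $OPT(I)>0$ the optimal value on instance $I$, the worst-case performance ratio $\varrho(LB)$ is the largest real number $\varrho\in[0,1]$ such that $LB(I)/OPT(I)\ge\varrho$ for all instances $I$. -}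

module Defs where

open import Level using (0ℓ)
open import Data.Nat.Base as ℕ using (ℕ; NonZero)
import Data.Nat.Properties as ℕ
import Data.Nat.ListAction as ListAction
open import Data.Integer.Base using (+_)
open import Data.Rational.Base as ℚ using (ℚ; 0ℚ; 1ℚ; ½; ∣_∣; Positive)
import Data.Rational.Properties as ℚ
open import Data.Bool.Base using (if_then_else_)
open import Data.Fin.Base using (Fin)
open import Data.Fin.Properties using (any?; _≟_)
open import Data.Fin.Subset using (Subset; _∈_; _∩_; Nonempty; Empty)
open import Data.Fin.Subset.Properties using (_∈?_)
open import Data.List.Base using (List; length; map)
open import Data.List.Relation.Unary.All using (All)
open import Data.List.Relation.Unary.AllPairs using (AllPairs)
open import Data.List.Relation.Unary.Any using (Any)
open import Data.Product.Base using (_×_; _,_; ∃; ∃-syntax)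
open import Data.Vec.Base using (lookup; tabulate)
open import Relation.Nullary.Decidable using (does; _×-dec_)
open import Relation.Binary.PropositionalEquality
  using (_≡_; refl; sym; trans; cong; subst)
open import Algebra.Bundles.Raw using (RawMonoid)
import Algebra.Definitions.RawMonoid as RawMonoidDefs
open import Data.Rational.Solver using (module +-*-Solver)

-- The real numbers, as Cauchy sequences of rationals taken up to _≈_.

record ℝ : Set where
  constructor mkℝ
  field
    seq    : ℕ → ℚ
    cauchy : ∀ ε → 0ℚ ℚ.< ε →
             ∃[ N ] ∀ m n → N ℕ.≤ m → N ℕ.≤ n → ∣ seq m ℚ.- seq n ∣ ℚ.< ε

open ℝ public

infix 4 _≤_ _≈_

_≤_ : ℝ → ℝ → Set
x ≤ y = ∀ ε → 0ℚ ℚ.< ε → ∃[ N ] ∀ n → N ℕ.≤ n → seq x n ℚ.≤ seq y n ℚ.+ ε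

_≈_ : ℝ → ℝ → Set
x ≈ y = x ≤ y × y ≤ x

fromℚ : ℚ → ℝ
fromℚ q = mkℝ (λ _ → q) λ ε 0<ε → 0 , λ _ _ _ _ →
  subst (ℚ._< ε) (sym (cong ∣_∣ (ℚ.+-inverseʳ q))) 0<ε

0ℝ 1ℝ : ℝ
0ℝ = fromℚ 0ℚ
1ℝ = fromℚ 1ℚ

private
  half-pos : ∀ ε → 0ℚ ℚ.< ε → 0ℚ ℚ.< ½ ℚ.* ε
  half-pos ε 0<ε = subst (ℚ._< ½ ℚ.* ε) (ℚ.*-zeroʳ ½) (ℚ.*-monoʳ-<-pos ½ 0<ε)

  halves : ∀ ε → ½ ℚ.* ε ℚ.+ ½ ℚ.* ε ≡ ε
  halves ε = trans (sym (ℚ.*-distribʳ-+ ε ½ ½)) (ℚ.*-identityˡ ε)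

  interchange : ∀ a b c d → (a ℚ.- c) ℚ.+ (b ℚ.- d) ≡ (a ℚ.+ b) ℚ.- (c ℚ.+ d)
  interchange = solve 4 (λ a b c d →
    (a :- c) :+ (b :- d) := (a :+ b) :- (c :+ d)) refl
    where open +-*-Solver

  ∣-∣-+ : ∀ a b c d ε → ∣ a ℚ.- c ∣ ℚ.< ½ ℚ.* ε → ∣ b ℚ.- d ∣ ℚ.< ½ ℚ.* ε →
          ∣ (a ℚ.+ b) ℚ.- (c ℚ.+ d) ∣ ℚ.< ε
  ∣-∣-+ a b c d ε h₁ h₂ = begin-strict
    ∣ (a ℚ.+ b) ℚ.- (c ℚ.+ d) ∣     ≡⟨ cong ∣_∣ (interchange a b c d) ⟨
    ∣ (a ℚ.- c) ℚ.+ (b ℚ.- d) ∣     ≤⟨ ℚ.∣p+q∣≤∣p∣+∣q∣ (a ℚ.- c) (b ℚ.- d) ⟩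
    ∣ a ℚ.- c ∣ ℚ.+ ∣ b ℚ.- d ∣     <⟨ ℚ.+-mono-< h₁ h₂ ⟩
    ½ ℚ.* ε ℚ.+ ½ ℚ.* ε             ≡⟨ halves ε ⟩
    ε                               ∎
    where open ℚ.≤-Reasoning

  factor : ∀ q a b → q ℚ.* (a ℚ.- b) ≡ q ℚ.* a ℚ.- q ℚ.* b
  factor = solve 3 (λ q a b → q :* (a :- b) := q :* a :- q :* b) refl
    where open +-*-Solver

  ∣-∣-* : ∀ q ε → 0ℚ ℚ.< ε →
          ∃[ δ ] 0ℚ ℚ.< δ ×
            (∀ a b → ∣ a ℚ.- b ∣ ℚ.< δ → ∣ q ℚ.* a ℚ.- q ℚ.* b ∣ ℚ.< ε)
  ∣-∣-* q ε 0<ε = go (∣ q ∣ ℚ.+ 1ℚ) c-pos ∣q∣≤c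
    where
    open ℚ.≤-Reasoning

    c-pos : Positive (∣ q ∣ ℚ.+ 1ℚ)
    c-pos = ℚ.nonNeg+pos⇒pos ∣ q ∣ {{ℚ.∣-∣-nonNeg q}} 1ℚ

    ∣q∣≤c : ∣ q ∣ ℚ.≤ ∣ q ∣ ℚ.+ 1ℚ
    ∣q∣≤c = subst (ℚ._≤ ∣ q ∣ ℚ.+ 1ℚ) (ℚ.+-identityʳ ∣ q ∣)
      (ℚ.+-monoʳ-≤ ∣ q ∣ (ℚ.nonNegative⁻¹ 1ℚ))

    go : ∀ c → Positive c → ∣ q ∣ ℚ.≤ c →
         ∃[ δ ] 0ℚ ℚ.< δ ×
           (∀ a b → ∣ a ℚ.- b ∣ ℚ.< δ → ∣ q ℚ.* a ℚ.- q ℚ.* b ∣ ℚ.< ε)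
    go c pos ∣q∣≤c = c⁻¹ ℚ.* ε , 0<δ , λ a b h → begin-strict
      ∣ q ℚ.* a ℚ.- q ℚ.* b ∣   ≡⟨ cong ∣_∣ (factor q a b) ⟨
      ∣ q ℚ.* (a ℚ.- b) ∣       ≡⟨ ℚ.∣p*q∣≡∣p∣*∣q∣ q (a ℚ.- b) ⟩
      ∣ q ∣ ℚ.* ∣ a ℚ.- b ∣
        ≤⟨ ℚ.*-monoʳ-≤-nonNeg ∣ a ℚ.- b ∣ {{ℚ.∣-∣-nonNeg (a ℚ.- b)}} ∣q∣≤c ⟩
      c ℚ.* ∣ a ℚ.- b ∣         <⟨ ℚ.*-monoʳ-<-pos c {{pos}} h ⟩
      c ℚ.* (c⁻¹ ℚ.* ε)         ≡⟨ ℚ.*-assoc c c⁻¹ ε ⟨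
      (c ℚ.* c⁻¹) ℚ.* ε
        ≡⟨ cong (ℚ._* ε) (ℚ.*-inverseʳ c {{ℚ.pos⇒nonZero c {{pos}}}}) ⟩
      1ℚ ℚ.* ε                  ≡⟨ ℚ.*-identityˡ ε ⟩
      ε                         ∎
      where
      c⁻¹ : ℚ
      c⁻¹ = ℚ.1/_ c {{ℚ.pos⇒nonZero c {{pos}}}}

      0<δ : 0ℚ ℚ.< c⁻¹ ℚ.* ε
      0<δ = subst (ℚ._< c⁻¹ ℚ.* ε) (ℚ.*-zeroʳ c⁻¹)
        (ℚ.*-monoʳ-<-pos c⁻¹ {{ℚ.1/pos⇒pos c {{pos}}}} 0<ε)

infixl 6 _+_

_+_ : ℝ → ℝ → ℝ
x + y = mkℝ (λ n → seq x n ℚ.+ seq y n) λ ε 0<ε →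
  let M , hx = cauchy x (½ ℚ.* ε) (half-pos ε 0<ε)
      N , hy = cauchy y (½ ℚ.* ε) (half-pos ε 0<ε)
  in M ℕ.⊔ N , λ m n ≤m ≤n →
    ∣-∣-+ (seq x m) (seq y m) (seq x n) (seq y n) ε
      (hx m n (ℕ.m⊔n≤o⇒m≤o M N ≤m) (ℕ.m⊔n≤o⇒m≤o M N ≤n))
      (hy m n (ℕ.m⊔n≤o⇒n≤o M N ≤m) (ℕ.m⊔n≤o⇒n≤o M N ≤n))

infixr 7 _·_

_·_ : ℚ → ℝ → ℝ
q · x = mkℝ (λ n → q ℚ.* seq x n) λ ε 0<ε →
  let δ , 0<δ , close = ∣-∣-* q ε 0<ε
      N , hx = cauchy x δ 0<δ
  in N , λ m n ≤m ≤n → close (seq x m) (seq x n) (hx m n ≤m ≤n)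

infixr 7 _·ℕ_
infixl 7 _/ℕ_

_·ℕ_ : ℕ → ℝ → ℝ
a ·ℕ x = ((+ a) ℚ./ 1) · x

_/ℕ_ : ℝ → (a : ℕ) → .{{NonZero a}} → ℝ
x /ℕ a = ((+ 1) ℚ./ a) · x

+-0-rawMonoid : RawMonoid 0ℓ 0ℓ
+-0-rawMonoid = record { Carrier = ℝ ; _≈_ = _≈_ ; _∙_ = _+_ ; ε = 0ℝ }

open RawMonoidDefs +-0-rawMonoid public using () renaming (sum to ∑)
open RawMonoidDefs ℕ.+-0-rawMonoid public using () renaming (sum to ∑ℕ)

∑∈ : ∀ {n} → Subset n → (Fin n → ℕ) → ℕ
∑∈ S g = ∑ℕ λ i → if lookup S i then g i else 0

-- The classes are the fibres of cls: item i lies in class c iff cls i ≡ c.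
record Instance : Set where
  field
    d n m r    : ℕ
    w          : Fin n → ℕ
    cls        : Fin n → Fin m
    s f        : Fin m → ℕ
    d≥1        : 1 ℕ.≤ d
    r≥1        : 1 ℕ.≤ r
    w≥1        : ∀ i → 1 ℕ.≤ w i
    nonempty   : ∀ c → ∃[ i ] cls i ≡ c
    fits       : ∀ c i → cls i ≡ c → w i ℕ.+ s c ℕ.≤ d
    not-in-one : d ℕ.< ∑ℕ w ℕ.+ ∑ℕ s

module _ (I : Instance) where
  open Instance I

  classesOf : Subset n → Subset m
  classesOf S = tabulate λ c → does (any? λ i → (i ∈? S) ×-dec (cls i ≟ c))

  IsPattern : Subset n → Set
  IsPattern S = ∑∈ S w ℕ.+ ∑∈ (classesOf S) s ℕ.≤ d

  -- A partition of the items, listed in arbitrary order; nonemptiness and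
  -- disjointness exclude repetitions, so length counts the used bins.
  record IsFeasible (𝒮 : List (Subset n)) : Set where
    field
      patterns : All IsPattern 𝒮
      nonempty : All Nonempty 𝒮
      disjoint : AllPairs (λ S T → Empty (S ∩ T)) 𝒮
      covers   : ∀ i → Any (i ∈_) 𝒮

  cost : List (Subset n) → ℕ
  cost 𝒮 = r ℕ.* length 𝒮 ℕ.+ ListAction.sum (map (λ S → ∑∈ (classesOf S) f) 𝒮)

  IsOptimal : List (Subset n) → Set
  IsOptimal 𝒮 = IsFeasible 𝒮 × (∀ 𝒯 → IsFeasible 𝒯 → cost 𝒮 ℕ.≤ cost 𝒯)

  IsOPT : ℕ → Set
  IsOPT o = ∃[ 𝒮 ] IsOptimal 𝒮 × cost 𝒮 ≡ o

  IsBinBound : ℕ → Set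
  IsBinBound k = 1 ℕ.≤ k × (∀ 𝒮 → IsOptimal 𝒮 → length 𝒮 ℕ.≤ k)

  module LPN (k : ℕ) where

    record Point : Set where
      field
        x : Fin n → Fin k → ℝ
        y : Fin m → Fin k → ℝ
        z : Fin k → ℝ

    module _ (p : Point) where
      open Point p

      Assigned Capacity Linked x-Bounds y-Bounds z-Bounds : Set
      Assigned = ∀ i → ∑ (λ b → x i b) ≈ 1ℝ
      Capacity = ∀ b → ∑ (λ i → w i ·ℕ x i b) + ∑ (λ c → s c ·ℕ y c b) ≤ d ·ℕ z b
      Linked   = ∀ c i b → cls i ≡ c → x i b ≤ y c b
      x-Bounds = ∀ i b → 0ℝ ≤ x i b × x i b ≤ 1ℝ
      y-Bounds = ∀ c b → 0ℝ ≤ y c b × y c b ≤ 1ℝ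
      z-Bounds = ∀ b → 0ℝ ≤ z b × z b ≤ 1ℝ

      IsFeasibleLP : Set
      IsFeasibleLP = Assigned × Capacity × Linked × x-Bounds × y-Bounds × z-Bounds

      objective : ℝ
      objective = ∑ λ b → r ·ℕ z b + ∑ (λ c → f c ·ℕ y c b)

    IsOptimalLP : Point → Set
    IsOptimalLP p = IsFeasibleLP p × (∀ q → IsFeasibleLP q → objective p ≤ objective q)

  Isζ-LPN : ℕ → ℝ → Set
  Isζ-LPN k v = ∃[ p ] LPN.IsOptimalLP k p × LPN.objective k p ≈ v

-- A lower bound is given by its graph: LB I v says that its value on I is v.
RatioAtLeast : (Instance → ℝ → Set) → ℝ → Set
RatioAtLeast LB ρ =
  ∀ I v o → LB I v → IsOPT I o → .{{_ : NonZero o}} → ρ ≤ v /ℕ o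

IsWorstCaseRatio : (Instance → ℝ → Set) → ℝ → Set
IsWorstCaseRatio LB ρ = Admissible ρ × (∀ σ → Admissible σ → σ ≤ ρ)
  where
  Admissible : ℝ → Set
  Admissible σ = 0ℝ ≤ σ × σ ≤ 1ℝ × RatioAtLeast LB σ

{-# OPTIONS --safe #-}
-- Take n items of weight 1 in a single class, with bin capacity 1, bin cost 1,
-- no setup weight and setup cost n. Every bin holds one item, so a packing costs
-- n (n + 1). Spreading items, setups and bins evenly over the k bins of the LP
-- pays for the setup only once: ζ = 2 n. The ratio 2 / (n + 1) tends to 0.
module Submission where

open import Data.Nat.Base as ℕ using (ℕ; zero; suc; NonZero; z≤n; s≤s)
import Data.Nat.Properties as ℕ
import Data.Nat.ListAction as ListAction
open import Data.Integer.Base as ℤ using (+_; +[1+_])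
import Data.Integer.Properties as ℤ
open import Data.Rational.Base as ℚ
  using (ℚ; mkℚ; 0ℚ; 1ℚ; ½; Positive; NonNegative; fromℚᵘ; toℚᵘ)
import Data.Rational.Properties as ℚ
open import Data.Rational.Unnormalised.Base as ℚᵘ using (ℚᵘ; mkℚᵘ; *≡*; *≤*)
import Data.Rational.Unnormalised.Properties as ℚᵘ
open import Data.Bool.Base using (true; false)
open import Data.Fin.Base using (Fin; zero; suc)
open import Data.Fin.Properties using (any?; injective⇒≤; _≟_)
open import Data.Fin.Subset using (Subset; _∈_; Nonempty; ⁅_⁆; ∣_∣)
open import Data.Fin.Subset.Properties
  using (_∈?_; ∣⁅x⁆∣≡1; x∈⁅x⁆; x∈⁅y⁆⇒x≡y; x∈p∩q⁻; x∈p∧x≢y⇒x∈p-y; x∈p⇒∣p-x∣<∣p∣)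
open import Data.List.Base using (List; []; _∷_; length; map; tabulate; lookup)
open import Data.List.Properties using (length-tabulate)
open import Data.List.Relation.Unary.All as All using (All; []; _∷_)
import Data.List.Relation.Unary.All.Properties as All
import Data.List.Relation.Unary.AllPairs.Properties as AllPairs
open import Data.List.Relation.Unary.Any using (index)
import Data.List.Relation.Unary.Any.Properties as Any
open import Data.List.Membership.Propositional.Properties using (∈-lookup)
open import Data.Product.Base using (_×_; _,_; proj₁; proj₂; ∃-syntax)
open import Data.Vec.Base using ([]; _∷_)
open import Function.Base using (_∘_)
open import Level using (0ℓ)
open import Relation.Nullary.Decidable using (yes; no; dec-true; _×-dec_)
open import Relation.Nullary.Negation using (contradiction)
open import Relation.Binary.Bundles using (Poset)
open import Relation.Binary.PropositionalEquality
  using (_≡_; refl; sym; trans; cong; cong₂; subst; subst₂; module ≡-Reasoning)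
open import Algebra.Bundles using (CommutativeMonoid)
import Algebra.Properties.CommutativeMonoid.Sum as Sum
import Relation.Binary.Reasoning.PartialOrder as ≤-Reasoning
open import Defs

-- Rational arithmetic

-- Division in `ℚ` normalises by a gcd and does not compute on variables. Identities between
-- fractions are therefore proved on unnormalised rationals, where they are integer
-- cross-multiplications, and carried over by `fromℚᵘ`.
fromℚᵘ-homo-+ : ∀ p q → fromℚᵘ (p ℚᵘ.+ q) ≡ fromℚᵘ p ℚ.+ fromℚᵘ q
fromℚᵘ-homo-+ p q = ℚ.toℚᵘ-injective (begin
  toℚᵘ (fromℚᵘ (p ℚᵘ.+ q))                ≈⟨ ℚ.toℚᵘ-fromℚᵘ (p ℚᵘ.+ q) ⟩
  p ℚᵘ.+ q                                ≈⟨ ℚᵘ.+-cong (ℚ.toℚᵘ-fromℚᵘ p) (ℚ.toℚᵘ-fromℚᵘ q) ⟨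
  toℚᵘ (fromℚᵘ p) ℚᵘ.+ toℚᵘ (fromℚᵘ q)    ≈⟨ ℚ.toℚᵘ-homo-+ (fromℚᵘ p) (fromℚᵘ q) ⟨
  toℚᵘ (fromℚᵘ p ℚ.+ fromℚᵘ q)            ∎)
  where open ℚᵘ.≃-Reasoning

fromℚᵘ-homo-* : ∀ p q → fromℚᵘ (p ℚᵘ.* q) ≡ fromℚᵘ p ℚ.* fromℚᵘ q
fromℚᵘ-homo-* p q = ℚ.toℚᵘ-injective (begin
  toℚᵘ (fromℚᵘ (p ℚᵘ.* q))                ≈⟨ ℚ.toℚᵘ-fromℚᵘ (p ℚᵘ.* q) ⟩
  p ℚᵘ.* q                                ≈⟨ ℚᵘ.*-cong (ℚ.toℚᵘ-fromℚᵘ p) (ℚ.toℚᵘ-fromℚᵘ q) ⟨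
  toℚᵘ (fromℚᵘ p) ℚᵘ.* toℚᵘ (fromℚᵘ q)    ≈⟨ ℚ.toℚᵘ-homo-* (fromℚᵘ p) (fromℚᵘ q) ⟨
  toℚᵘ (fromℚᵘ p ℚ.* fromℚᵘ q)            ∎)
  where open ℚᵘ.≃-Reasoning

fromℚᵘ-mono-≤ : ∀ {p q} → p ℚᵘ.≤ q → fromℚᵘ p ℚ.≤ fromℚᵘ q
fromℚᵘ-mono-≤ {p} {q} p≤q = ℚ.toℚᵘ-cancel-≤
  (ℚᵘ.≤-respˡ-≃ (ℚᵘ.≃-sym (ℚ.toℚᵘ-fromℚᵘ p))
    (ℚᵘ.≤-respʳ-≃ (ℚᵘ.≃-sym (ℚ.toℚᵘ-fromℚᵘ q)) p≤q))

-- By definition the scalar inside `_·ℕ_`, so the rational facts below apply directly to the LP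
-- coefficients.
fromℕ : ℕ → ℚ
fromℕ a = (+ a) ℚ./ 1

fromℕ-homo-+ : ∀ a b → fromℕ (a ℕ.+ b) ≡ fromℕ a ℚ.+ fromℕ b
fromℕ-homo-+ a b = trans
  (ℚ.fromℚᵘ-cong {mkℚᵘ (+ (a ℕ.+ b)) 0} {mkℚᵘ (+ a) 0 ℚᵘ.+ mkℚᵘ (+ b) 0} (*≡* (cong (ℤ._* (+ 1))
    (sym (cong₂ ℤ._+_ (ℤ.*-identityʳ (+ a)) (ℤ.*-identityʳ (+ b)))))))
  (fromℚᵘ-homo-+ (mkℚᵘ (+ a) 0) (mkℚᵘ (+ b) 0))

fromℕ-homo-* : ∀ a b → fromℕ (a ℕ.* b) ≡ fromℕ a ℚ.* fromℕ b
fromℕ-homo-* a b = trans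
  (ℚ.fromℚᵘ-cong {mkℚᵘ (+ (a ℕ.* b)) 0} {mkℚᵘ (+ a) 0 ℚᵘ.* mkℚᵘ (+ b) 0} (*≡* (cong (ℤ._* (+ 1)) (ℤ.pos-* a b))))
  (fromℚᵘ-homo-* (mkℚᵘ (+ a) 0) (mkℚᵘ (+ b) 0))

fromℕ-mono-≤ : ∀ {a b} → a ℕ.≤ b → fromℕ a ℚ.≤ fromℕ b
fromℕ-mono-≤ {a} {b} a≤b = fromℚᵘ-mono-≤ {mkℚᵘ (+ a) 0} {mkℚᵘ (+ b) 0}
  (*≤* (ℤ.*-monoʳ-≤-nonNeg (+ 1) (ℤ.+≤+ a≤b)))

fromℕ-inverse : ∀ a .{{_ : NonZero a}} → fromℕ a ℚ.* ((+ 1) ℚ./ a) ≡ 1ℚ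
fromℕ-inverse (suc a) = trans
  (sym (fromℚᵘ-homo-* (mkℚᵘ +[1+ a ] 0) (mkℚᵘ (+ 1) a)))
  (ℚ.fromℚᵘ-cong {mkℚᵘ +[1+ a ] 0 ℚᵘ.* mkℚᵘ (+ 1) a} {mkℚᵘ (+ 1) 0} (*≡* (cong +_ (cong suc (eq a)))))
  where
  eq : ∀ a → a ℕ.* 1 ℕ.* 1 ≡ a ℕ.+ 0 ℕ.+ 0
  eq a = trans (ℕ.*-identityʳ (a ℕ.* 1)) (trans (ℕ.*-identityʳ a)
    (sym (trans (ℕ.+-identityʳ (a ℕ.+ 0)) (ℕ.+-identityʳ a))))

1/-nonNeg : ∀ a .{{_ : NonZero a}} → NonNegative ((+ 1) ℚ./ a)
1/-nonNeg a = ℚ.normalize-nonNeg 1 a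

-- The denominator of ε is the witness: multiplying ε by it leaves the numerator, a positive
-- integer.
archimedean : ∀ ε → 0ℚ ℚ.< ε → ∃[ a ] 1ℚ ℚ.≤ fromℕ a ℚ.* ε
archimedean ε 0<ε = go ε (ℚ.positive 0<ε)
  where
  go : ∀ ε → Positive ε → ∃[ a ] 1ℚ ℚ.≤ fromℕ a ℚ.* ε
  go ε@(mkℚ +[1+ p ] q _) _ = suc q ,
    subst (1ℚ ℚ.≤_)
      (trans (fromℚᵘ-homo-* (mkℚᵘ +[1+ q ] 0) (toℚᵘ ε))
        (cong (fromℕ (suc q) ℚ.*_) (ℚ.fromℚᵘ-toℚᵘ ε)))
      (fromℚᵘ-mono-≤ {mkℚᵘ (+ 1) 0} {mkℚᵘ +[1+ q ] 0 ℚᵘ.* toℚᵘ ε} (*≤* (ℤ.+≤+ bound)))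
    where
    bound : 1 ℕ.* suc (q ℕ.+ 0) ℕ.≤ suc q ℕ.* suc p ℕ.* 1
    bound = subst₂ ℕ._≤_
      (sym (trans (ℕ.*-identityˡ _) (cong suc (ℕ.+-identityʳ q))))
      (sym (ℕ.*-identityʳ (suc q ℕ.* suc p)))
      (ℕ.m≤m*n (suc q) (suc p))

-- The ordered group of real numbers

-- _≤_ and _≈_ unfold to properties of the sequences, from which Agda cannot
-- recover the endpoints: they are passed explicitly throughout.

half-pos : ∀ ε → 0ℚ ℚ.< ε → 0ℚ ℚ.< ½ ℚ.* ε
half-pos ε 0<ε = subst (ℚ._< ½ ℚ.* ε) (ℚ.*-zeroʳ ½) (ℚ.*-monoʳ-<-pos ½ 0<ε)

halves : ∀ ε → ½ ℚ.* ε ℚ.+ ½ ℚ.* ε ≡ ε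
halves ε = trans (sym (ℚ.*-distribʳ-+ ε ½ ½)) (ℚ.*-identityˡ ε)

p≤p+ε : ∀ p {ε} → 0ℚ ℚ.< ε → p ℚ.≤ p ℚ.+ ε
p≤p+ε p {ε} 0<ε =
  subst (ℚ._≤ p ℚ.+ ε) (ℚ.+-identityʳ p) (ℚ.+-monoʳ-≤ p (ℚ.<⇒≤ 0<ε))

≤-eventually₂ : ∀ {x y u v} → x ≤ y → u ≤ v → ∀ ε → 0ℚ ℚ.< ε →
  ∃[ N ] ∀ n → N ℕ.≤ n → seq x n ℚ.≤ seq y n ℚ.+ ε × seq u n ℚ.≤ seq v n ℚ.+ ε
≤-eventually₂ x≤y u≤v ε 0<ε =
  let M , h₁ = x≤y ε 0<ε
      N , h₂ = u≤v ε 0<ε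
  in M ℕ.⊔ N , λ n ≤n →
    h₁ n (ℕ.m⊔n≤o⇒m≤o M N ≤n) , h₂ n (ℕ.m⊔n≤o⇒n≤o M N ≤n)

-- With `≈-pointwise`, the route by which algebraic laws of `ℚ` become laws of `ℝ`: both sides are
-- compared term by term, and the tolerance is slack.
≤-pointwise : ∀ x y → (∀ n → seq x n ℚ.≤ seq y n) → x ≤ y
≤-pointwise x y h ε 0<ε = 0 , λ n _ → ℚ.≤-trans (h n) (p≤p+ε (seq y n) 0<ε)

≈-pointwise : ∀ x y → (∀ n → seq x n ≡ seq y n) → x ≈ y
≈-pointwise x y h =
  ≤-pointwise x y (ℚ.≤-reflexive ∘ h) , ≤-pointwise y x (ℚ.≤-reflexive ∘ sym ∘ h)

≤-trans : ∀ {x y z} → x ≤ y → y ≤ z → x ≤ z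
≤-trans {x} {y} {z} x≤y y≤z ε 0<ε =
  let N , h = ≤-eventually₂ {x} {y} {y} {z} x≤y y≤z (½ ℚ.* ε) (half-pos ε 0<ε)
  in N , λ n ≤n → begin
    seq x n                                ≤⟨ proj₁ (h n ≤n) ⟩
    seq y n ℚ.+ ½ ℚ.* ε                    ≤⟨ ℚ.+-monoˡ-≤ (½ ℚ.* ε) (proj₂ (h n ≤n)) ⟩
    seq z n ℚ.+ ½ ℚ.* ε ℚ.+ ½ ℚ.* ε        ≡⟨ ℚ.+-assoc (seq z n) (½ ℚ.* ε) (½ ℚ.* ε) ⟩
    seq z n ℚ.+ (½ ℚ.* ε ℚ.+ ½ ℚ.* ε)      ≡⟨ cong (seq z n ℚ.+_) (halves ε) ⟩
    seq z n ℚ.+ ε                          ∎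
  where open ℚ.≤-Reasoning

≈-refl : ∀ {x} → x ≈ x
≈-refl {x} = ≈-pointwise x x λ _ → refl

≈-sym : ∀ {x y} → x ≈ y → y ≈ x
≈-sym (x≤y , y≤x) = y≤x , x≤y

≈-trans : ∀ {x y z} → x ≈ y → y ≈ z → x ≈ z
≈-trans {x} {y} {z} (x≤y , y≤x) (y≤z , z≤y) =
  ≤-trans {x} {y} {z} x≤y y≤z , ≤-trans {z} {y} {x} z≤y y≤x

≤-poset : Poset 0ℓ 0ℓ 0ℓ
≤-poset = record
  { Carrier = ℝ
  ; _≈_ = _≈_
  ; _≤_ = _≤_
  ; isPartialOrder = record
    { isPreorder = record
      { isEquivalence = record
        { refl = λ {x} → ≈-refl {x}
        ; sym = λ {x} {y} → ≈-sym {x} {y}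
        ; trans = λ {x} {y} {z} → ≈-trans {x} {y} {z}
        }
      ; reflexive = proj₁
      ; trans = λ {x} {y} {z} → ≤-trans {x} {y} {z}
      }
    ; antisym = _,_
    }
  }

+-mono-≤ : ∀ {x y u v} → x ≤ y → u ≤ v → x + u ≤ y + v
+-mono-≤ {x} {y} {u} {v} x≤y u≤v ε 0<ε =
  let N , h = ≤-eventually₂ {x} {y} {u} {v} x≤y u≤v (½ ℚ.* ε) (half-pos ε 0<ε)
  in N , λ n ≤n → begin
    seq x n ℚ.+ seq u n
      ≤⟨ ℚ.+-mono-≤ (proj₁ (h n ≤n)) (proj₂ (h n ≤n)) ⟩
    (seq y n ℚ.+ ½ ℚ.* ε) ℚ.+ (seq v n ℚ.+ ½ ℚ.* ε)
      ≡⟨ interchange (seq y n) (½ ℚ.* ε) (seq v n) (½ ℚ.* ε) ⟩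
    (seq y n ℚ.+ seq v n) ℚ.+ (½ ℚ.* ε ℚ.+ ½ ℚ.* ε)
      ≡⟨ cong (seq y n ℚ.+ seq v n ℚ.+_) (halves ε) ⟩
    seq y n ℚ.+ seq v n ℚ.+ ε ∎
  where
  open ℚ.≤-Reasoning
  open import Algebra.Properties.CommutativeSemigroup
    (CommutativeMonoid.commutativeSemigroup ℚ.+-0-commutativeMonoid)
    using (interchange)

+-cong : ∀ {x y u v} → x ≈ y → u ≈ v → x + u ≈ y + v
+-cong {x} {y} {u} {v} (x≤y , y≤x) (u≤v , v≤u) =
  +-mono-≤ {x} {y} {u} {v} x≤y u≤v , +-mono-≤ {y} {x} {v} {u} y≤x v≤u

-- Its raw part is the monoid over which `∑` is defined, so the library's lemmas on sums speak of
-- the same `∑`.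
+-0-commutativeMonoid : CommutativeMonoid 0ℓ 0ℓ
+-0-commutativeMonoid = record
  { Carrier = ℝ
  ; _≈_ = _≈_
  ; _∙_ = _+_
  ; ε = 0ℝ
  ; isCommutativeMonoid = record
    { isMonoid = record
      { isSemigroup = record
        { isMagma = record
          { isEquivalence = Poset.isEquivalence ≤-poset
          ; ∙-cong = λ {x} {y} {u} {v} → +-cong {x} {y} {u} {v}
          }
        ; assoc = λ x y z → ≈-pointwise (x + y + z) (x + (y + z)) λ n → ℚ.+-assoc (seq x n) (seq y n) (seq z n)
        }
      ; identity = (λ x → ≈-pointwise (0ℝ + x) x λ n → ℚ.+-identityˡ (seq x n))
                 , (λ x → ≈-pointwise (x + 0ℝ) x λ n → ℚ.+-identityʳ (seq x n))
      }
    ; comm = λ x y → ≈-pointwise (x + y) (y + x) λ n → ℚ.+-comm (seq x n) (seq y n)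
    }
  }

open CommutativeMonoid +-0-commutativeMonoid using () renaming (identityʳ to +-identityʳ)
open Sum +-0-commutativeMonoid using (∑-comm; ∑-distrib-+; sum-cong-≋)

fromℚ-mono-≤ : ∀ {p q} → p ℚ.≤ q → fromℚ p ≤ fromℚ q
fromℚ-mono-≤ {p} {q} p≤q = ≤-pointwise (fromℚ p) (fromℚ q) λ _ → p≤q

-- The passage to the limit: for a tolerance ε, half of it is spent on the bound `q` and half on the
-- comparison with `fromℚ q`.
≤0-fromℚ : ∀ x → (∀ q → 0ℚ ℚ.< q → x ≤ fromℚ q) → x ≤ 0ℝ
≤0-fromℚ x h ε 0<ε =
  let N , hN = h (½ ℚ.* ε) (half-pos ε 0<ε) (½ ℚ.* ε) (half-pos ε 0<ε)
  in N , λ n ≤n → subst (seq x n ℚ.≤_)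
    (trans (halves ε) (sym (ℚ.+-identityˡ ε))) (hN n ≤n)

-- An error δ in `x` becomes `q` times δ. Since `q` may be zero, δ is ε divided by `c`, which stands
-- for q + 1, rather than by `q`.
·-nonNeg : ∀ q .{{_ : NonNegative q}} x → 0ℝ ≤ x → 0ℝ ≤ q · x
·-nonNeg q x 0≤x ε 0<ε = go (q ℚ.+ 1ℚ) (ℚ.nonNeg+pos⇒pos q 1ℚ) (p≤p+ε q (ℚ.positive⁻¹ 1ℚ))
  where
  go : ∀ c → Positive c → q ℚ.≤ c →
       ∃[ N ] ∀ n → N ℕ.≤ n → 0ℚ ℚ.≤ q ℚ.* seq x n ℚ.+ ε
  go c pos q≤c =
    let N , h = 0≤x δ 0<δ
    in N , λ n ≤n → begin
      0ℚ                           ≡⟨ ℚ.*-zeroʳ q ⟨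
      q ℚ.* 0ℚ                     ≤⟨ ℚ.*-monoˡ-≤-nonNeg q (h n ≤n) ⟩
      q ℚ.* (seq x n ℚ.+ δ)        ≡⟨ ℚ.*-distribˡ-+ q (seq x n) δ ⟩
      q ℚ.* seq x n ℚ.+ q ℚ.* δ    ≤⟨ ℚ.+-monoʳ-≤ (q ℚ.* seq x n) qδ≤ε ⟩
      q ℚ.* seq x n ℚ.+ ε          ∎
    where
    open ℚ.≤-Reasoning
    instance _ = pos
    instance _ = ℚ.pos⇒nonZero c
    δ : ℚ
    δ = ℚ.1/ c ℚ.* ε
    0<δ : 0ℚ ℚ.< δ
    0<δ = subst (ℚ._< δ) (ℚ.*-zeroʳ (ℚ.1/ c))
      (ℚ.*-monoʳ-<-pos (ℚ.1/ c) {{ℚ.1/pos⇒pos c}} 0<ε)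
    qδ≤ε : q ℚ.* δ ℚ.≤ ε
    qδ≤ε = begin
      q ℚ.* δ                      ≤⟨ ℚ.*-monoʳ-≤-nonNeg δ {{ℚ.nonNegative (ℚ.<⇒≤ 0<δ)}} q≤c ⟩
      c ℚ.* (ℚ.1/ c ℚ.* ε)         ≡⟨ ℚ.*-assoc c (ℚ.1/ c) ε ⟨
      c ℚ.* ℚ.1/ c ℚ.* ε           ≡⟨ cong (ℚ._* ε) (ℚ.*-inverseʳ c) ⟩
      1ℚ ℚ.* ε                     ≡⟨ ℚ.*-identityˡ ε ⟩
      ε                            ∎

·ℕ-nonNeg : ∀ a x → 0ℝ ≤ x → 0ℝ ≤ a ·ℕ x
·ℕ-nonNeg a = ·-nonNeg (fromℕ a) {{ℚ.normalize-nonNeg a 1}}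

1·ℕ : ∀ x → 1 ·ℕ x ≈ x
1·ℕ x = ≈-pointwise (1 ·ℕ x) x λ n → ℚ.*-identityˡ (seq x n)

0·ℕ : ∀ x → 0 ·ℕ x ≈ 0ℝ
0·ℕ x = ≈-pointwise (0 ·ℕ x) 0ℝ λ n → ℚ.*-zeroˡ (seq x n)

·ℕ-fromℚ-monoˡ-≤ : ∀ {a b} q .{{_ : NonNegative q}} → a ℕ.≤ b → a ·ℕ fromℚ q ≤ b ·ℕ fromℚ q
·ℕ-fromℚ-monoˡ-≤ {a} {b} q a≤b = ≤-pointwise (a ·ℕ fromℚ q) (b ·ℕ fromℚ q) λ _ →
  ℚ.*-monoʳ-≤-nonNeg q (fromℕ-mono-≤ a≤b)

-- Finite sums of real numbers

∑-cong : ∀ {n} {g h : Fin n → ℝ} → (∀ i → g i ≈ h i) → ∑ g ≈ ∑ h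
∑-cong {n} {g} {h} = sum-cong-≋ {n} {g} {h}

∑-mono-≤ : ∀ {n} {g h : Fin n → ℝ} → (∀ i → g i ≤ h i) → ∑ g ≤ ∑ h
∑-mono-≤ {zero}          _   = proj₁ (≈-refl {0ℝ})
∑-mono-≤ {suc n} {g} {h} g≤h =
  +-mono-≤ {g zero} {h zero} {∑ (g ∘ suc)} {∑ (h ∘ suc)} (g≤h zero)
    (∑-mono-≤ {n} {g ∘ suc} {h ∘ suc} (g≤h ∘ suc))

∑-const : ∀ n x → ∑ {n} (λ _ → x) ≈ n ·ℕ x
∑-const n x = ≈-pointwise (∑ {n} (λ _ → x)) (n ·ℕ x) (go n)
  where
  go : ∀ n j → seq (∑ {n} (λ _ → x)) j ≡ fromℕ n ℚ.* seq x j
  go zero    j = sym (ℚ.*-zeroˡ (seq x j))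
  go (suc n) j = begin
    seq x j ℚ.+ seq (∑ {n} (λ _ → x)) j
      ≡⟨ cong₂ ℚ._+_ (sym (ℚ.*-identityˡ (seq x j))) (go n j) ⟩
    1ℚ ℚ.* seq x j ℚ.+ fromℕ n ℚ.* seq x j        ≡⟨ ℚ.*-distribʳ-+ (seq x j) 1ℚ (fromℕ n) ⟨
    (1ℚ ℚ.+ fromℕ n) ℚ.* seq x j                  ≡⟨ cong (ℚ._* seq x j) (fromℕ-homo-+ 1 n) ⟨
    fromℕ (suc n) ℚ.* seq x j                     ∎
    where open ≡-Reasoning

∑-nonNeg : ∀ {n} {g : Fin n → ℝ} → (∀ i → 0ℝ ≤ g i) → 0ℝ ≤ ∑ g
∑-nonNeg {n} {g} 0≤g = begin
  0ℝ                  ≈⟨ ≈-pointwise (n ·ℕ 0ℝ) 0ℝ (λ _ → ℚ.*-zeroʳ (fromℕ n)) ⟨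
  n ·ℕ 0ℝ             ≈⟨ ∑-const n 0ℝ ⟨
  ∑ {n} (λ _ → 0ℝ)    ≤⟨ ∑-mono-≤ {n} {λ _ → 0ℝ} {g} 0≤g ⟩
  ∑ g                 ∎
  where open ≤-Reasoning ≤-poset

-- Double counting: after exchanging the sums every row contributes 1. It serves both the lower
-- bound on the LP and the value of the even point.
∑-columns : ∀ {n k} (x : Fin n → Fin k → ℝ) → (∀ i → ∑ (x i) ≈ 1ℝ) →
            ∑ (λ b → ∑ (λ i → x i b)) ≈ n ·ℕ 1ℝ
∑-columns {n} x rows = begin-equality
  ∑ (λ b → ∑ (λ i → x i b))    ≈⟨ ∑-comm x ⟨
  ∑ (λ i → ∑ (x i))            ≈⟨ ∑-cong {n} {∑ ∘ x} {λ _ → 1ℝ} rows ⟩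
  ∑ {n} (λ _ → 1ℝ)             ≈⟨ ∑-const n 1ℝ ⟩
  n ·ℕ 1ℝ                      ∎
  where open ≤-Reasoning ≤-poset

-- Weights of subsets

∑∈-one : ∀ {n} (S : Subset n) → ∑∈ S (λ _ → 1) ≡ ∣ S ∣
∑∈-one []          = refl
∑∈-one (true ∷ S)  = cong suc (∑∈-one S)
∑∈-one (false ∷ S) = ∑∈-one S

∑∈-zero : ∀ {n} (S : Subset n) → ∑∈ S (λ _ → 0) ≡ 0
∑∈-zero []          = refl
∑∈-zero (true ∷ S)  = ∑∈-zero S
∑∈-zero (false ∷ S) = ∑∈-zero S

-- If `i` and `j` differed, `i` would survive the removal of `j`, giving 1 ≤ |S - j| < |S| ≤ 1.
∣S∣≤1⇒≡ : ∀ {n} {S : Subset n} → ∣ S ∣ ℕ.≤ 1 → ∀ {i j} → i ∈ S → j ∈ S → i ≡ j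
∣S∣≤1⇒≡ {S = S} S≤1 {i} {j} i∈S j∈S with i ≟ j
... | yes i≡j = i≡j
... | no  i≢j = contradiction
  (ℕ.≤-trans (s≤s (ℕ.≤-trans (s≤s z≤n) (x∈p⇒∣p-x∣<∣p∣ (x∈p∧x≢y⇒x∈p-y i∈S i≢j))))
    (ℕ.≤-trans (x∈p⇒∣p-x∣<∣p∣ j∈S) S≤1))
  (ℕ.<-irrefl refl)

sum-map-const : ∀ {A : Set} {g : A → ℕ} {a} {xs : List A} →
                All (λ x → g x ≡ a) xs → ListAction.sum (map g xs) ≡ length xs ℕ.* a
sum-map-const []        = refl
sum-map-const (eq ∷ es) = cong₂ ℕ._+_ eq (sum-map-const es)

-- Costs are natural numbers and `y`, `z` are nonnegative. This makes the ratio 0 admissible.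
objective-nonNeg : ∀ I k p → LPN.IsFeasibleLP I k p → 0ℝ ≤ LPN.objective I k p
objective-nonNeg I k p (_ , _ , _ , _ , y-bounds , z-bounds) =
  ∑-nonNeg {k} {λ b → r ·ℕ z b + ∑ (λ c → f c ·ℕ y c b)} λ b → begin
    0ℝ                                      ≈⟨ +-identityʳ 0ℝ ⟨
    0ℝ + 0ℝ                                 ≤⟨ +-mono-≤ {0ℝ} {r ·ℕ z b} {0ℝ} {∑ (λ c → f c ·ℕ y c b)}
                                                 (·ℕ-nonNeg r (z b) (proj₁ (z-bounds b)))
                                                 (∑-nonNeg {m} {λ c → f c ·ℕ y c b}
                                                   λ c → ·ℕ-nonNeg (f c) (y c b) (proj₁ (y-bounds c b))) ⟩
    r ·ℕ z b + ∑ (λ c → f c ·ℕ y c b)       ∎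
  where
  open Instance I
  open LPN.Point p
  open ≤-Reasoning ≤-poset

-- The instances of vanishing ratio

module UnitItems (N : ℕ) where

  -- At least two items, so that the total weight exceeds the capacity 1 as `not-in-one` demands.
  n : ℕ
  n = suc (suc N)

  I : Instance
  I = record
    { d = 1 ; n = n ; m = 1 ; r = 1
    ; w = λ _ → 1
    ; cls = λ _ → zero
    ; s = λ _ → 0
    ; f = λ _ → n
    ; d≥1 = ℕ.≤-refl
    ; r≥1 = ℕ.≤-refl
    ; w≥1 = λ _ → ℕ.≤-refl
    ; nonempty = λ { zero → zero , refl }
    ; fits = λ _ _ _ → ℕ.≤-refl
    ; not-in-one = s≤s (s≤s z≤n)
    }

  -- Integral packings of the unit items

  pattern⇒∣S∣≤1 : ∀ {S} → IsPattern I S → ∣ S ∣ ℕ.≤ 1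
  pattern⇒∣S∣≤1 {S} h = begin
    ∣ S ∣                                                      ≡⟨ ∑∈-one S ⟨
    ∑∈ S (λ _ → 1)                                             ≤⟨ ℕ.m≤m+n _ _ ⟩
    ∑∈ S (λ _ → 1) ℕ.+ ∑∈ (classesOf I S) (λ _ → 0)            ≤⟨ h ⟩
    1                                                          ∎
    where open ℕ.≤-Reasoning

  ∣S∣≤1⇒pattern : ∀ {S} → ∣ S ∣ ℕ.≤ 1 → IsPattern I S
  ∣S∣≤1⇒pattern {S} h = begin
    ∑∈ S (λ _ → 1) ℕ.+ ∑∈ (classesOf I S) (λ _ → 0)            ≡⟨ cong₂ ℕ._+_ (∑∈-one S) (∑∈-zero (classesOf I S)) ⟩
    ∣ S ∣ ℕ.+ 0                                                ≡⟨ ℕ.+-identityʳ ∣ S ∣ ⟩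
    ∣ S ∣                                                      ≤⟨ h ⟩
    1                                                          ∎
    where open ℕ.≤-Reasoning

  -- With a single class, `classesOf I S` is one bit, the decision whether some item lies in `S`;
  -- the given item makes it true.
  setup-cost : ∀ {S} → Nonempty S → ∑∈ (classesOf I S) (λ _ → n) ≡ n
  setup-cost {S} (i , i∈S)
    rewrite dec-true (any? λ j → (j ∈? S) ×-dec (zero {0} ≟ zero)) (i , i∈S , refl) =
    ℕ.+-identityʳ n

  -- Each used bin pays 1 for itself and `n` for the setup, so the cost depends only on the number
  -- of bins.
  cost-feasible : ∀ {𝒮} → IsFeasible I 𝒮 → cost I 𝒮 ≡ length 𝒮 ℕ.* suc n
  cost-feasible {𝒮} feasible = trans
    (cong₂ ℕ._+_ (ℕ.*-identityˡ (length 𝒮))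
      (sum-map-const (All.map setup-cost (IsFeasible.nonempty feasible))))
    (sym (ℕ.*-suc (length 𝒮) n))

  -- Pigeonhole: sending each item to the position of a bin that contains it is injective, because a
  -- pattern holds at most one item.
  n≤length : ∀ {𝒮} → IsFeasible I 𝒮 → n ℕ.≤ length 𝒮
  n≤length {𝒮} feasible = injective⇒≤ {f = λ i → index (covers i)} λ {i} {j} eq →
    ∣S∣≤1⇒≡ (pattern⇒∣S∣≤1 {lookup 𝒮 (index (covers j))} (All.lookup patterns (∈-lookup (index (covers j)))))
      (subst (λ b → i ∈ lookup 𝒮 b) eq (Any.lookup-index (covers i)))
      (Any.lookup-index (covers j))
    where open IsFeasible feasible

  singletons : List (Subset n)
  singletons = tabulate ⁅_⁆

  singletons-feasible : IsFeasible I singletons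
  singletons-feasible = record
    { patterns = All.tabulate⁺ {f = ⁅_⁆} λ i → ∣S∣≤1⇒pattern {⁅ i ⁆} (ℕ.≤-reflexive (∣⁅x⁆∣≡1 i))
    ; nonempty = All.tabulate⁺ {f = ⁅_⁆} λ i → i , x∈⁅x⁆ i
    ; disjoint = AllPairs.tabulate⁺ {f = ⁅_⁆} λ {i} {j} i≢j (a , a∈) →
        let a∈i , a∈j = x∈p∩q⁻ ⁅ i ⁆ ⁅ j ⁆ a∈
        in i≢j (trans (sym (x∈⁅y⁆⇒x≡y i a∈i)) (x∈⁅y⁆⇒x≡y j a∈j))
    ; covers = λ i → Any.tabulate⁺ {f = ⁅_⁆} i (x∈⁅x⁆ i)
    }

  cost-singletons : cost I singletons ≡ n ℕ.* suc n
  cost-singletons =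
    trans (cost-feasible singletons-feasible) (cong (ℕ._* suc n) (length-tabulate {n = n} ⁅_⁆))

  singletons-optimal : IsOptimal I singletons
  singletons-optimal = singletons-feasible , λ 𝒯 feasible → begin
    cost I singletons          ≡⟨ cost-singletons ⟩
    n ℕ.* suc n                ≤⟨ ℕ.*-monoˡ-≤ (suc n) (n≤length feasible) ⟩
    length 𝒯 ℕ.* suc n         ≡⟨ cost-feasible feasible ⟨
    cost I 𝒯                   ∎
    where open ℕ.≤-Reasoning

  opt : IsOPT I (n ℕ.* suc n)
  opt = singletons , singletons-optimal , cost-singletons

  -- The singleton packing is itself optimal and uses `n` bins. The bound is what allows z = n / k
  -- in the LP.
  bin-bound⇒n≤k : ∀ {k} → IsBinBound I k → n ℕ.≤ k
  bin-bound⇒n≤k {k} (_ , bound) =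
    subst (ℕ._≤ k) (length-tabulate {n = n} ⁅_⁆) (bound singletons singletons-optimal)

  -- The LP value and its ratio to the optimum

  ζ : ℝ
  ζ = n ·ℕ 1ℝ + n ·ℕ 1ℝ

  module _ (k : ℕ) (n≤k : n ℕ.≤ k) where
    open LPN I k
    -- Coefficients below are written with these projections, not as the literals they
    -- reduce to: otherwise Agda compares the Cauchy proofs inside each real number.
    open Instance I using (d; r; w; s; f)
    open ≤-Reasoning ≤-poset

    -- With unit weights and no setup weight, the load of a bin is its total assignment.
    capacity-≈ : ∀ (x : Fin n → ℝ) (y : Fin 1 → ℝ) →
                 ∑ (λ i → 1 ·ℕ x i) + ∑ (λ c → 0 ·ℕ y c) ≈ ∑ x
    capacity-≈ x y = begin-equality
      -- The sum over the single class unfolds to its one term plus `0ℝ`.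
      ∑ (λ i → 1 ·ℕ x i) + (0 ·ℕ y zero + 0ℝ)
        ≈⟨ +-cong {∑ (λ i → 1 ·ℕ x i)} {∑ x} {0 ·ℕ y zero + 0ℝ} {0ℝ}
             (∑-cong {n} {λ i → 1 ·ℕ x i} {x} (1·ℕ ∘ x))
             (+-cong {0 ·ℕ y zero} {0ℝ} {0ℝ} {0ℝ} (0·ℕ (y zero)) (≈-refl {0ℝ})) ⟩
      ∑ x + 0ℝ
        ≈⟨ +-identityʳ (∑ x) ⟩
      ∑ x ∎

    -- In every bin, the capacity constraint bounds the total assignment by z and
    -- the linking constraints bound it by n y.
    ζ≤objective : ∀ p → IsFeasibleLP p → ζ ≤ objective p
    ζ≤objective p (assigned , capacity , linked , _) = begin
      n ·ℕ 1ℝ + n ·ℕ 1ℝ         ≈⟨ +-cong {∑ X} {n ·ℕ 1ℝ} {∑ X} {n ·ℕ 1ℝ} (∑-columns x assigned) (∑-columns x assigned) ⟨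
      ∑ X + ∑ X                 ≈⟨ ∑-distrib-+ X X ⟨
      ∑ (λ b → X b + X b)       ≤⟨ ∑-mono-≤ {k} {λ b → X b + X b} {λ b → r ·ℕ z b + ∑ (λ c → f c ·ℕ y c b)} (λ b →
                                     +-mono-≤ {X b} {r ·ℕ z b} {X b} {∑ (λ c → f c ·ℕ y c b)} (X≤z b) (X≤ny b)) ⟩
      objective p               ∎
      where
      open Point p
      X : Fin k → ℝ
      X b = ∑ λ i → x i b
      X≤z : ∀ b → X b ≤ 1 ·ℕ z b
      X≤z b = begin
        X b                                                         ≈⟨ capacity-≈ (λ i → x i b) (λ c → y c b) ⟨
        ∑ (λ i → 1 ·ℕ x i b) + ∑ (λ c → 0 ·ℕ y c b)                 ≤⟨ capacity b ⟩
        1 ·ℕ z b                                                    ∎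
      X≤ny : ∀ b → X b ≤ n ·ℕ y zero b + 0ℝ
      X≤ny b = begin
        X b                       ≤⟨ ∑-mono-≤ {n} {λ i → x i b} {λ _ → y zero b} (λ i → linked zero i b refl) ⟩
        ∑ {n} (λ _ → y zero b)    ≈⟨ ∑-const n (y zero b) ⟩
        n ·ℕ y zero b             ≈⟨ +-identityʳ (n ·ℕ y zero b) ⟨
        n ·ℕ y zero b + 0ℝ        ∎

    instance
      k≢0 : NonZero k
      k≢0 = ℕ.>-nonZero (ℕ.≤-trans (s≤s z≤n) n≤k)

      1/k-nonNeg : NonNegative ((+ 1) ℚ./ k)
      1/k-nonNeg = 1/-nonNeg k

    1/k : ℝ
    1/k = fromℚ ((+ 1) ℚ./ k)

    -- Every bin has total assignment n / k, equal both to its `z` and to `n` times its `y`. Hence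
    -- the two estimates behind `ζ≤objective` are tight here.
    even : Point
    even = record { x = λ _ _ → 1/k ; y = λ _ _ → 1/k ; z = λ _ → n ·ℕ 1/k }

    k·1/k≈1 : k ·ℕ 1/k ≈ 1ℝ
    k·1/k≈1 = ≈-pointwise (k ·ℕ 1/k) 1ℝ λ _ → fromℕ-inverse k

    ∑1/k≈1 : ∑ {k} (λ _ → 1/k) ≈ 1ℝ
    ∑1/k≈1 = begin-equality
      ∑ {k} (λ _ → 1/k)    ≈⟨ ∑-const k 1/k ⟩
      k ·ℕ 1/k             ≈⟨ k·1/k≈1 ⟩
      1ℝ                   ∎

    -- Applied with a = n to bound `z`, and with a = 1 to bound `x` and `y`.
    a·1/k-bounds : ∀ a → a ℕ.≤ k → 0ℝ ≤ a ·ℕ 1/k × a ·ℕ 1/k ≤ 1ℝ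
    a·1/k-bounds a a≤k =
      ·ℕ-nonNeg a 1/k (fromℚ-mono-≤ {0ℚ} {(+ 1) ℚ./ k} (ℚ.nonNegative⁻¹ ((+ 1) ℚ./ k))) , (begin
        a ·ℕ 1/k    ≤⟨ ·ℕ-fromℚ-monoˡ-≤ ((+ 1) ℚ./ k) a≤k ⟩
        k ·ℕ 1/k    ≈⟨ k·1/k≈1 ⟩
        1ℝ          ∎)

    1/k-bounds : 0ℝ ≤ 1/k × 1/k ≤ 1ℝ
    1/k-bounds =
      let 0≤ , ≤1 = a·1/k-bounds 1 (ℕ.≤-trans (s≤s z≤n) n≤k)
      in (begin 0ℝ ≤⟨ 0≤ ⟩ 1 ·ℕ 1/k ≈⟨ 1·ℕ 1/k ⟩ 1/k ∎)
       , (begin 1/k ≈⟨ 1·ℕ 1/k ⟨ 1 ·ℕ 1/k ≤⟨ ≤1 ⟩ 1ℝ ∎)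

    even-feasible : IsFeasibleLP even
    even-feasible =
        (λ _ → ∑1/k≈1)
      , (λ b → begin
          ∑ (λ i → w i ·ℕ x i b) + ∑ (λ c → s c ·ℕ y c b)    ≈⟨ capacity-≈ (λ i → x i b) (λ c → y c b) ⟩
          ∑ {n} (λ _ → 1/k)                                  ≈⟨ ∑-const n 1/k ⟩
          n ·ℕ 1/k                                           ≈⟨ 1·ℕ (n ·ℕ 1/k) ⟨
          d ·ℕ z b                                           ∎)
      , (λ _ _ _ _ → proj₁ (≈-refl {1/k}))
      , (λ _ _ → 1/k-bounds)
      , (λ _ _ → 1/k-bounds)
      , (λ _ → a·1/k-bounds n n≤k)
      where open Point even

    objective-even : objective even ≈ ζ
    objective-even = begin-equality
      objective even                    ≈⟨ ∑-cong {k} {λ b → r ·ℕ z b + ∑ (λ c → f c ·ℕ y c b)} {λ _ → X + X} (λ b →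
                                             +-cong {r ·ℕ z b} {X} {∑ (λ c → f c ·ℕ y c b)} {X} z≈X y≈X) ⟩
      ∑ {k} (λ _ → X + X)               ≈⟨ ∑-distrib-+ {k} (λ _ → X) (λ _ → X) ⟩
      ∑ {k} (λ _ → X) + ∑ {k} (λ _ → X) ≈⟨ +-cong {∑ {k} (λ _ → X)} {n ·ℕ 1ℝ} {∑ {k} (λ _ → X)} {n ·ℕ 1ℝ} ∑X ∑X ⟩
      n ·ℕ 1ℝ + n ·ℕ 1ℝ                 ∎
      where
      open Point even
      X : ℝ
      -- The share n / k is written as a column sum so that `∑-columns` totals it to `n`. In each
      -- bin it is both the bin cost and the setup cost.
      X = ∑ {n} (λ _ → 1/k)
      z≈X : 1 ·ℕ n ·ℕ 1/k ≈ X
      z≈X = begin-equality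
        1 ·ℕ n ·ℕ 1/k    ≈⟨ 1·ℕ (n ·ℕ 1/k) ⟩
        n ·ℕ 1/k         ≈⟨ ∑-const n 1/k ⟨
        X                ∎
      y≈X : n ·ℕ 1/k + 0ℝ ≈ X
      y≈X = begin-equality
        n ·ℕ 1/k + 0ℝ    ≈⟨ +-identityʳ (n ·ℕ 1/k) ⟩
        n ·ℕ 1/k         ≈⟨ ∑-const n 1/k ⟨
        X                ∎
      ∑X : ∑ {k} (λ _ → X) ≈ n ·ℕ 1ℝ
      ∑X = ∑-columns {n} {k} (λ _ _ → 1/k) (λ _ → ∑1/k≈1)

    isζ : Isζ-LPN I k ζ
    isζ = even , (even-feasible , λ q feasible → begin
        objective even    ≈⟨ objective-even ⟩
        ζ                 ≤⟨ ζ≤objective q feasible ⟩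
        objective q       ∎)
      , objective-even

  -- The quotient is 2 n / (n (n + 1)) = 2 / (n + 1), and the hypothesis is this bound by δ with the
  -- denominator cleared.
  ratio : ∀ δ → fromℕ 2 ℚ.≤ fromℕ (suc n) ℚ.* δ → ζ /ℕ (n ℕ.* suc n) ≤ fromℚ δ
  ratio δ h = ≤-pointwise (ζ /ℕ (n ℕ.* suc n)) (fromℚ δ) λ _ → begin
    -- Factoring out `ν` leaves 1 + 1, which computes to `fromℕ 2`.
    o⁻¹ ℚ.* (ν ℚ.* 1ℚ ℚ.+ ν ℚ.* 1ℚ)          ≡⟨ cong (o⁻¹ ℚ.*_) (ℚ.*-distribˡ-+ ν 1ℚ 1ℚ) ⟨
    o⁻¹ ℚ.* (ν ℚ.* fromℕ 2)                  ≤⟨ ℚ.*-monoˡ-≤-nonNeg o⁻¹ {{1/-nonNeg o}}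
                                                  (ℚ.*-monoˡ-≤-nonNeg ν {{ℚ.normalize-nonNeg n 1}} h) ⟩
    o⁻¹ ℚ.* (ν ℚ.* (fromℕ (suc n) ℚ.* δ))    ≡⟨ cong (o⁻¹ ℚ.*_) (ℚ.*-assoc ν (fromℕ (suc n)) δ) ⟨
    o⁻¹ ℚ.* (ν ℚ.* fromℕ (suc n) ℚ.* δ)      ≡⟨ cong (λ a → o⁻¹ ℚ.* (a ℚ.* δ)) (fromℕ-homo-* n (suc n)) ⟨
    o⁻¹ ℚ.* (fromℕ o ℚ.* δ)                  ≡⟨ ℚ.*-assoc o⁻¹ (fromℕ o) δ ⟨
    o⁻¹ ℚ.* fromℕ o ℚ.* δ                    ≡⟨ cong (ℚ._* δ) (trans (ℚ.*-comm o⁻¹ (fromℕ o)) (fromℕ-inverse o)) ⟩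
    1ℚ ℚ.* δ                                 ≡⟨ ℚ.*-identityˡ δ ⟩
    δ                                        ∎
    where
    open ℚ.≤-Reasoning
    o : ℕ
    o = n ℕ.* suc n
    ν o⁻¹ : ℚ
    ν = fromℕ n
    o⁻¹ = (+ 1) ℚ./ o

unit-items-ratio : ∀ δ → 0ℚ ℚ.< δ →
  ∃[ N ] UnitItems.ζ N /ℕ (UnitItems.n N ℕ.* suc (UnitItems.n N)) ≤ fromℚ δ
unit-items-ratio δ 0<δ =
  let a , 1≤aδ = archimedean δ 0<δ
      -- From 1 ≤ a δ follows 2 ≤ N δ, and the factor n + 1 = N + 3 required by `ratio` is larger
      -- still.
      N = 2 ℕ.* a
  in N , UnitItems.ratio N δ (begin
    fromℕ 2                          ≡⟨ ℚ.*-identityʳ (fromℕ 2) ⟨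
    fromℕ 2 ℚ.* 1ℚ                   ≤⟨ ℚ.*-monoˡ-≤-nonNeg (fromℕ 2) 1≤aδ ⟩
    fromℕ 2 ℚ.* (fromℕ a ℚ.* δ)      ≡⟨ ℚ.*-assoc (fromℕ 2) (fromℕ a) δ ⟨
    fromℕ 2 ℚ.* fromℕ a ℚ.* δ        ≡⟨ cong (ℚ._* δ) (fromℕ-homo-* 2 a) ⟨
    fromℕ N ℚ.* δ                    ≤⟨ ℚ.*-monoʳ-≤-nonNeg δ {{ℚ.nonNegative (ℚ.<⇒≤ 0<δ)}}
                                          (fromℕ-mono-≤ (ℕ.m≤n+m N 3)) ⟩
    fromℕ (3 ℕ.+ N) ℚ.* δ            ∎)
  where open ℚ.≤-Reasoning

proposition2 : (k : Instance → ℕ) → (∀ I → IsBinBound I (k I)) →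
    IsWorstCaseRatio (λ I v → Isζ-LPN I (k I) v) 0ℝ
proposition2 k bound =
    ( proj₁ (≈-refl {0ℝ})
    , fromℚ-mono-≤ {0ℚ} {1ℚ} (ℚ.nonNegative⁻¹ 1ℚ)
    -- The value `v` is at least the objective of a feasible point, hence nonnegative, and dividing
    -- by the optimum preserves this.
    , λ I v o (p , (feasible , _) , obj≤v , _) _ →
        ·-nonNeg ((+ 1) ℚ./ o) {{1/-nonNeg o}} v
          (≤-trans {0ℝ} {LPN.objective I (k I) p} {v} (objective-nonNeg I (k I) p feasible) obj≤v))
  -- An admissible σ lies below the ratio of every unit-item instance, hence below every positive
  -- rational δ.
  , λ σ (_ , _ , σ≤ratio) → ≤0-fromℚ σ λ δ 0<δ →
      let N , ratio≤δ = unit-items-ratio δ 0<δ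
          open UnitItems N
          o = n ℕ.* suc n
      in ≤-trans {σ} {ζ /ℕ o} {fromℚ δ}
           (σ≤ratio I ζ o (isζ (k I) (bin-bound⇒n≤k (bound I))) opt) ratio≤δ
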